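{- There exists an algorithm in the proportional setting that is given only a parameter $0<\varepsilon<1$ (and in particular has no information about $n=|U|$) and that, for every instance $(U,w)$ with $n=|U|\ge 2$ and $W=\sum_{a\in U}w(a)>0$, returns an estimate $\hat W$ such that with probability at least $2/3$ one has $(1-\varepsilon)W\le\hat W\le(1+\varepsilon)W$, and whose expected number of samples is $$O\left(\frac{\sqrt n}{\varepsilon}+\frac{\log n}{\varepsilon^2}\right),$$ where the implied constant is absolute.
   Context: An instance $(U,w)$ consists of a finite set $U$ and a weight function $w:U\to[0,\infty)$; $W=\sum_{a\in U}w(a)$. Proportional setting: a (randomized, adaptive) algorithm can interact with the instance only by (1) drawing an independent proportional sample, which returns $(a,w(a))$ where item $a$ is returned with probability $w(a)/W$; (2) testing, for two sampled items $a,a'$, whether $a=a'$. Its sample complexity is the number of samples it draws. -}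

module Defs where

open import Level using (Level; _⊔_) renaming (suc to lsuc)
open import Algebra.Bundles using (CommutativeRing)
import Algebra.Definitions.RawMonoid as RawMonoid
open import Data.Bool.Base using (Bool; true; false; if_then_else_)
open import Data.Fin.Base using (Fin)
open import Data.Fin.Properties using (_≟_)
open import Data.Maybe.Base using (Maybe; just; nothing; maybe′)
open import Data.Nat.Base using (ℕ; zero; suc)
open import Data.Product.Base using (∃-syntax; _×_)
open import Data.Vec.Base using (Vec; []; _∷_; lookup)
open import Relation.Binary.Core using (Rel)
open import Relation.Binary.Structures using (IsDecTotalOrder)
import Relation.Binary.Construct.NonStrictToStrict as Strict
open import Relation.Nullary using (does)
open import Relation.Nullary.Decidable using (_×-dec_)
open import Relation.Unary using (Pred; Decidable)

-- The real numbers enter only through these axioms.  The (classical) real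
-- numbers satisfy them, and so does ℚ; up to isomorphism the models are
-- classically exactly the subfields of ℝ.
record ArchimedeanOrderedField (c ℓ₁ ℓ₂ : Level) : Set (lsuc (c ⊔ ℓ₁ ⊔ ℓ₂)) where
  infix 4 _≤_
  infix 8 _⁻¹
  infixl 7 _/_
  field
    commutativeRing : CommutativeRing c ℓ₁

  open CommutativeRing commutativeRing public
  open RawMonoid +-rawMonoid public using (sum) renaming (_×_ to _•_)

  field
    _≤_             : Rel Carrier ℓ₂
    isDecTotalOrder : IsDecTotalOrder _≈_ _≤_
    _⁻¹             : Carrier → Carrier   -- unspecified at 0#

  open IsDecTotalOrder isDecTotalOrder public
    using (_≤?_) renaming (_≟_ to _≈?_)
  open Strict _≈_ _≤_ public using () renaming (_<_ to infix 4 _<_)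

  fromℕ : ℕ → Carrier
  fromℕ k = k • 1#

  field
    0<1         : 0# < 1#
    ⁻¹-inverseʳ : ∀ x → x ≉ 0# → x * x ⁻¹ ≈ 1#
    +-monoʳ-≤   : ∀ x {y z} → y ≤ z → x + y ≤ x + z
    *-nonNeg    : ∀ {x y} → 0# ≤ x → 0# ≤ y → 0# ≤ x * y
    archimedean : ∀ x → ∃[ k ] x ≤ fromℕ k

  _/_ : Carrier → Carrier → Carrier
  x / y = x * y ⁻¹

module Proportional {c ℓ₁ ℓ₂ : Level} (R : ArchimedeanOrderedField c ℓ₁ ℓ₂) where
  open ArchimedeanOrderedField R

  record Instance : Set (c ⊔ ℓ₂) where
    field
      size     : ℕ
      weight   : Fin size → Carrier
      weight≥0 : ∀ a → 0# ≤ weight a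

    total : Carrier
    total = sum weight

  open Instance public

  -- What an algorithm knows after m samples.  It sees the weight of a sampled
  -- item but not the item, which it can only refer to by its position among
  -- the samples drawn so far.
  data History : ℕ → Set c where
    start    : History 0
    sampled  : ∀ {m} → History m → Carrier → History (suc m)
    tested   : ∀ {m} → History m → Bool → History m
    coinFlip : ∀ {m} → History m → Bool → History m

  data Action (m : ℕ) : Set c where
    sample : Action m
    test   : Fin m → Fin m → Action m   -- position 0 is the latest sample
    flip   : Action m                   -- a fair coin: internal randomness
    return : Carrier → Action m

  Strategy : Set c
  Strategy = ∀ {m} → History m → Action m

  -- The argument is the accuracy parameter ε.
  Algorithm : Set c
  Algorithm = Carrier → Strategy

  module Run (A : Strategy) (I : Instance) where

    -- E k h xs f is the expectation of f over k further steps, where f receives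
    -- the returned value (nothing if the run has not yet returned) and
    -- the number of samples drawn; xs are the items behind the history h.
    E : ℕ → ∀ {m} → History m → Vec (Fin (size I)) m →
        (Maybe Carrier → ℕ → Carrier) → Carrier
    E′ : ℕ → ∀ {m} → Action m → History m → Vec (Fin (size I)) m →
         (Maybe Carrier → ℕ → Carrier) → Carrier

    E zero    {m} h xs f = f nothing m
    E (suc k)     h xs f = E′ k (A h) h xs f

    E′ k     sample     h xs f =
      sum (λ a → weight I a / total I * E k (sampled h (weight I a)) (a ∷ xs) f)
    E′ k     (test i j) h xs f =
      E k (tested h (does (lookup xs i ≟ lookup xs j))) xs f
    E′ k     flip       h xs f =
      (E k (coinFlip h true) xs f + E k (coinFlip h false) xs f) / fromℕ 2
    E′ k {m} (return x) h xs f = f (just x) m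

    Pr≤ : ∀ {p} {P : Pred Carrier p} → Decidable P → ℕ → Carrier
    Pr≤ P? k =
      E k start [] (λ r _ → maybe′ (λ x → if does (P? x) then 1# else 0#) 0# r)

    HaltPr≤ : ℕ → Carrier
    HaltPr≤ k = E k start [] (λ r _ → maybe′ (λ _ → 1#) 0# r)

    Samples≤ : ℕ → Carrier
    Samples≤ k = E k start [] (λ _ m → fromℕ m)

    -- The three sequences above are nondecreasing in the number k of steps, and
    -- the probability (expectation) for the unbounded run is their supremum.
    -- It is compared with a bound without assuming that suprema exist in R.
    SupAtLeast : (ℕ → Carrier) → Carrier → Set (c ⊔ ℓ₁ ⊔ ℓ₂)
    SupAtLeast u b = ∀ q → q < b → ∃[ k ] q < u k

    SupAtMost : (ℕ → Carrier) → Carrier → Set ℓ₂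
    SupAtMost u b = ∀ k → u k ≤ b

    HaltsAlmostSurely : Set (c ⊔ ℓ₁ ⊔ ℓ₂)
    HaltsAlmostSurely = SupAtLeast HaltPr≤ 1#

    ReturnsWithProbability≥ : ∀ {p} {P : Pred Carrier p} →
      Carrier → Decidable P → Set (c ⊔ ℓ₁ ⊔ ℓ₂)
    ReturnsWithProbability≥ b P? = SupAtLeast (Pr≤ P?) b

    ExpectedSamples≤ : Carrier → Set ℓ₂
    ExpectedSamples≤ b = SupAtMost Samples≤ b

  open Run public
    using (HaltsAlmostSurely; ReturnsWithProbability≥; ExpectedSamples≤)

  Accurate : Carrier → Instance → Pred Carrier ℓ₂
  Accurate ε I x = ((1# - ε) * total I ≤ x) × (x ≤ (1# + ε) * total I)

  accurate? : ∀ ε I → Decidable (Accurate ε I)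
  accurate? ε I x = ((1# - ε) * total I ≤? x) ×-dec (x ≤? (1# + ε) * total I)

  infix 4 _≥√_

  -- s ≥ √ n.  As R need not contain √ n, bounds that are increasing in √ n are
  -- required for every s ≥ √ n in R; if √ n ∈ R, this is the bound at s = √ n.
  _≥√_ : Carrier → ℕ → Set ℓ₂
  s ≥√ n = (0# ≤ s) × (fromℕ n ≤ s * s)

module Submission where

-- The algorithm samples until K = ⌈3/ε²⌉ samples have repeated an earlier item.
-- If Sᵢ is the set of items among the first i samples, the next sample is a
-- repeat with probability w(Sᵢ)/W.  Hence the number X of repeats minus
-- ν = Σᵢ w(Sᵢ)/W is a martingale, and stopping at X = K gives
-- E[(K - ν)²] ≤ E[ν] = K.  By Chebyshev's inequality ν is within εK of K with
-- probability at least 1 - 1/(ε²K) ≥ 2/3, and then Wν/K, which the algorithm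
-- can compute, is accurate.
--
-- For the running time call an item big if its probability is at least 1/(2n);
-- the big items have total probability at least 1/2.  So every sample is a
-- repeat or a new big item with probability at least 1/2, and once L ≈ √n/ε big
-- items have been seen a repeat has probability at least L/(2n).  This makes a
-- linear combination of the missing repeats and the missing big items decrease
-- by at least 1 per sample in expectation.

open import Defs
open import Data.Bool.Base using (Bool; true; false; if_then_else_; _∨_; _∧_; not)
open import Data.Bool.Properties using (∨-assoc; ∨-identityʳ)
open import Data.Fin.Base using (Fin; zero; suc)
open import Data.Fin.Properties using (_≟_)
open import Data.List.Base using (List; []; _∷_; length; tabulate)
open import Data.Maybe.Base using (Maybe; just; nothing)
open import Data.Nat.Base as ℕ using (ℕ; zero; suc; _∸_)
open import Data.Nat.Logarithm using (⌊log₂_⌋; ⌊log₂⌋-mono-≤)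
open import Data.Product.Base using (Σ-syntax; ∃-syntax; _×_; _,_; proj₁; proj₂)
open import Data.Sum.Base using (_⊎_; inj₁; inj₂)
open import Data.Vec.Base using (Vec; []; _∷_; lookup)
open import Relation.Binary.Bundles using (Poset)
open import Relation.Binary.PropositionalEquality.Core as ≡ using (_≡_)
open import Relation.Binary.Structures using (IsDecTotalOrder)
open import Relation.Nullary using (¬_; Dec; yes; no; does; contradiction)
import Algebra.Properties.AbelianGroup as AbelianGroupProperties
import Algebra.Properties.Monoid.Mult as Mult
import Algebra.Properties.Ring as RingProperties
import Algebra.Properties.Semiring.Sum as Sum
import Algebra.Solver.Ring.NaturalCoefficients.Default as NatSolver
import Data.Nat.Properties as ℕ
import Relation.Binary.Construct.NonStrictToStrict as Strict
import Relation.Binary.Reasoning.PartialOrder as PosetReasoning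

-- Arithmetic in an ordered field, numerals and finite sums.

module OrderedField {c ℓ₁ ℓ₂} (R : ArchimedeanOrderedField c ℓ₁ ℓ₂) where
  open ArchimedeanOrderedField R hiding (zero)
  open RingProperties ring public
    using (-‿distribˡ-*; -‿distribʳ-*; -‿involutive)
  open IsDecTotalOrder isDecTotalOrder public
    using (antisym; isPartialOrder)
    renaming (total to ≤-total; trans to ≤-trans; reflexive to ≤-reflexive; refl to ≤-refl)
  open NatSolver commutativeSemiring public using (Polynomial; solve; _:+_; _:*_; _:=_; con)
  open Sum semiring public
    using (sum-cong-≋; ∑-distrib-+; *-distribˡ-sum; *-distribʳ-sum; sum-replicate; sum-replicate-zero)

  -- Evaluates to the same nested sum as `fromℕ k`, so that `solve` matches goals with constants
  -- such as `fromℕ 4`; `con 2` matches `2#` instead.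
  numeral : ∀ {m} → ℕ → Polynomial m
  numeral zero    = con 0
  numeral (suc k) = con 1 :+ numeral k

  poset : Poset c ℓ₁ ℓ₂
  poset = record { isPartialOrder = isPartialOrder }

  module ≤-Reasoning = PosetReasoning poset
  open ≤-Reasoning

  2# : Carrier
  2# = 1# + 1#

  ⟦_⟧ : Bool → Carrier
  ⟦ b ⟧ = if b then 1# else 0#

  ≰⇒≥ : ∀ {x y} → ¬ (x ≤ y) → y ≤ x
  ≰⇒≥ {x} {y} x≰y with ≤-total x y
  ... | inj₁ x≤y = contradiction x≤y x≰y
  ... | inj₂ y≤x = y≤x

  <⇒≱ : ∀ {x y} → x < y → ¬ (y ≤ x)
  <⇒≱ = Strict.<⇒≱ _≈_ _≤_ antisym

  +-mono-≤ : ∀ {x y u v} → x ≤ y → u ≤ v → x + u ≤ y + v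
  +-mono-≤ {x} {y} {u} {v} x≤y u≤v = begin
    x + u  ≤⟨ +-monoʳ-≤ x u≤v ⟩
    x + v  ≈⟨ +-comm x v ⟩
    v + x  ≤⟨ +-monoʳ-≤ v x≤y ⟩
    v + y  ≈⟨ +-comm v y ⟩
    y + v  ∎

  +-monoˡ-≤ : ∀ z {x y} → x ≤ y → x + z ≤ y + z
  +-monoˡ-≤ z x≤y = +-mono-≤ x≤y ≤-refl

  x+y-y≈x : ∀ x y → (x + y) - y ≈ x
  x+y-y≈x x y = trans (+-assoc x y (- y)) (trans (+-congˡ (-‿inverseʳ y)) (+-identityʳ x))

  x-y+y≈x : ∀ x y → (x - y) + y ≈ x
  x-y+y≈x x y = trans (+-assoc x (- y) y) (trans (+-congˡ (-‿inverseˡ y)) (+-identityʳ x))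

  +-cancelʳ-≤ : ∀ z {x y} → x + z ≤ y + z → x ≤ y
  +-cancelʳ-≤ z {x} {y} x+z≤y+z = begin
    x            ≈⟨ x+y-y≈x x z ⟨
    (x + z) - z  ≤⟨ +-monoˡ-≤ (- z) x+z≤y+z ⟩
    (y + z) - z  ≈⟨ x+y-y≈x y z ⟩
    y            ∎

  x≤y⇒0≤y-x : ∀ {x y} → x ≤ y → 0# ≤ y - x
  x≤y⇒0≤y-x {x} {y} x≤y = begin
    0#     ≈⟨ -‿inverseʳ x ⟨
    x - x  ≤⟨ +-monoˡ-≤ (- x) x≤y ⟩
    y - x  ∎

  x+y≤z⇒x≤z-y : ∀ {x y z} → x + y ≤ z → x ≤ z - y
  x+y≤z⇒x≤z-y {x} {y} {z} p = begin
    x            ≈⟨ x+y-y≈x x y ⟨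
    (x + y) - y  ≤⟨ +-monoˡ-≤ (- y) p ⟩
    z - y        ∎

  x≤x+y : ∀ x {y} → 0# ≤ y → x ≤ x + y
  x≤x+y x {y} 0≤y = begin
    x       ≈⟨ +-identityʳ x ⟨
    x + 0#  ≤⟨ +-monoʳ-≤ x 0≤y ⟩
    x + y   ∎

  +-nonNeg : ∀ {x y} → 0# ≤ x → 0# ≤ y → 0# ≤ x + y
  +-nonNeg {x} 0≤x 0≤y = ≤-trans 0≤x (x≤x+y x 0≤y)

  0≤1 : 0# ≤ 1#
  0≤1 = proj₁ 0<1

  0≤2 : 0# ≤ 2#
  0≤2 = +-nonNeg 0≤1 0≤1

  ⟦_⟧≤1 : ∀ b → ⟦ b ⟧ ≤ 1#
  ⟦ true ⟧≤1  = ≤-refl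
  ⟦ false ⟧≤1 = 0≤1

  *-monoˡ-≤ : ∀ {z} → 0# ≤ z → ∀ {x y} → x ≤ y → z * x ≤ z * y
  *-monoˡ-≤ {z} 0≤z {x} {y} x≤y = begin
    z * x                ≤⟨ x≤x+y (z * x) (*-nonNeg 0≤z (x≤y⇒0≤y-x x≤y)) ⟩
    z * x + z * (y - x)  ≈⟨ distribˡ z x (y - x) ⟨
    z * (x + (y - x))    ≈⟨ *-congˡ (trans (+-comm _ _) (x-y+y≈x y x)) ⟩
    z * y                ∎

  *-monoʳ-≤ : ∀ {z} → 0# ≤ z → ∀ {x y} → x ≤ y → x * z ≤ y * z
  *-monoʳ-≤ {z} 0≤z {x} {y} x≤y = begin
    x * z  ≈⟨ *-comm x z ⟩
    z * x  ≤⟨ *-monoˡ-≤ 0≤z x≤y ⟩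
    z * y  ≈⟨ *-comm z y ⟩
    y * z  ∎

  -x*-x≈x*x : ∀ x → (- x) * (- x) ≈ x * x
  -x*-x≈x*x x = trans (sym (-‿distribˡ-* x (- x)))
                (trans (-‿cong (sym (-‿distribʳ-* x x))) (-‿involutive (x * x)))

  x≤0⇒0≤-x : ∀ {x} → x ≤ 0# → 0# ≤ - x
  x≤0⇒0≤-x {x} x≤0 = ≤-trans (x≤y⇒0≤y-x x≤0) (≤-reflexive (+-identityˡ (- x)))

  0≤x*x : ∀ x → 0# ≤ x * x
  0≤x*x x with ≤-total 0# x
  ... | inj₁ 0≤x = *-nonNeg 0≤x 0≤x
  ... | inj₂ x≤0 = ≤-trans (*-nonNeg (x≤0⇒0≤-x x≤0) (x≤0⇒0≤-x x≤0)) (≤-reflexive (-x*-x≈x*x x))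

  *-mono-square : ∀ {x y} → 0# ≤ x → x ≤ y → x * x ≤ y * y
  *-mono-square 0≤x x≤y = ≤-trans (*-monoˡ-≤ 0≤x x≤y) (*-monoʳ-≤ (≤-trans 0≤x x≤y) x≤y)

  ⁻¹-inverse : ∀ {x} → 0# < x → x * x ⁻¹ ≈ 1#
  ⁻¹-inverse (_ , 0≉x) = ⁻¹-inverseʳ _ (λ x≈0 → 0≉x (sym x≈0))

  ⁻¹-nonNeg : ∀ {x} → 0# < x → 0# ≤ x ⁻¹
  ⁻¹-nonNeg {x} 0<x with ≤-total 0# (x ⁻¹)
  ... | inj₁ p = p
  ... | inj₂ p = contradiction 1≤0 (<⇒≱ 0<1)
    where
    1≤0 : 1# ≤ 0#
    1≤0 = begin
      1#            ≈⟨ ⁻¹-inverse 0<x ⟨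
      x * x ⁻¹      ≤⟨ *-monoˡ-≤ (proj₁ 0<x) p ⟩
      x * 0#        ≈⟨ zeroʳ x ⟩
      0#            ∎

  x*y/y≈x : ∀ x {y} → 0# < y → (x * y) / y ≈ x
  x*y/y≈x x {y} 0<y = trans (*-assoc x y (y ⁻¹)) (trans (*-congˡ (⁻¹-inverse 0<y)) (*-identityʳ x))

  x/y*y≈x : ∀ x {y} → 0# < y → (x / y) * y ≈ x
  x/y*y≈x x {y} 0<y = trans (*-assoc x (y ⁻¹) y)
    (trans (*-congˡ (trans (*-comm _ _) (⁻¹-inverse 0<y))) (*-identityʳ x))

  *-cancelʳ-≤ : ∀ {z} → 0# < z → ∀ {x y} → x * z ≤ y * z → x ≤ y
  *-cancelʳ-≤ {z} 0<z {x} {y} p = begin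
    x            ≈⟨ x*y/y≈x x 0<z ⟨
    (x * z) / z  ≤⟨ *-monoʳ-≤ (⁻¹-nonNeg 0<z) p ⟩
    (y * z) / z  ≈⟨ x*y/y≈x y 0<z ⟩
    y            ∎

  *-pos : ∀ {x y} → 0# < x → 0# < y → 0# < x * y
  *-pos {x} {y} (0≤x , 0≉x) 0<y = *-nonNeg 0≤x (proj₁ 0<y) , λ 0≈xy →
    0≉x (trans (sym (zeroˡ (y ⁻¹))) (trans (*-congʳ 0≈xy) (x*y/y≈x x 0<y)))

  <-≤-trans : ∀ {x y z} → x < y → y ≤ z → x < z
  <-≤-trans (x≤y , x≉y) y≤z =
    ≤-trans x≤y y≤z , λ x≈z → x≉y (antisym x≤y (≤-trans y≤z (≤-reflexive (sym x≈z))))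

  x*z≤y⇒x≤y/z : ∀ {x y z} → 0# < z → x * z ≤ y → x ≤ y / z
  x*z≤y⇒x≤y/z {x} {y} 0<z p = *-cancelʳ-≤ 0<z (≤-trans p (≤-reflexive (sym (x/y*y≈x y 0<z))))

  fromℕ-+ : ∀ m n → fromℕ (m ℕ.+ n) ≈ fromℕ m + fromℕ n
  fromℕ-+ = Mult.×-homo-+ +-monoid 1#

  0≤fromℕ : ∀ n → 0# ≤ fromℕ n
  0≤fromℕ zero    = ≤-refl
  0≤fromℕ (suc n) = +-nonNeg 0≤1 (0≤fromℕ n)

  0<fromℕ : ∀ n → 0# < fromℕ (suc n)
  0<fromℕ n = <-≤-trans 0<1 (x≤x+y 1# (0≤fromℕ n))

  fromℕ-mono-≤ : ∀ {m n} → m ℕ.≤ n → fromℕ m ≤ fromℕ n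
  fromℕ-mono-≤ {n = n} ℕ.z≤n = 0≤fromℕ n
  fromℕ-mono-≤ (ℕ.s≤s p)     = +-monoʳ-≤ 1# (fromℕ-mono-≤ p)

  fromℕ-cancel-≤ : ∀ {m n} → fromℕ m ≤ fromℕ n → m ℕ.≤ n
  fromℕ-cancel-≤ {m} {n} p with m ℕ.≤? n
  ... | yes m≤n = m≤n
  ... | no m≰n  = contradiction (+-cancelʳ-≤ (fromℕ n) 1+n≤0+n) (<⇒≱ 0<1)
    where
    1+n≤0+n : 1# + fromℕ n ≤ 0# + fromℕ n
    1+n≤0+n = begin
      fromℕ (suc n)  ≤⟨ fromℕ-mono-≤ (ℕ.≰⇒> m≰n) ⟩
      fromℕ m        ≤⟨ p ⟩
      fromℕ n        ≈⟨ +-identityˡ _ ⟨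
      0# + fromℕ n   ∎

  -- Search downwards from an Archimedean bound until the predecessor no longer bounds `x`. For
  -- negative `x` the search ends at 0, so the upper estimate is conditional on `0# ≤ x`.
  ceiling : ∀ x → ∃[ k ] (x ≤ fromℕ k × (0# ≤ x → fromℕ k ≤ x + 1#))
  ceiling x = search (proj₁ (archimedean x)) (proj₂ (archimedean x))
    where
    search : ∀ k → x ≤ fromℕ k → ∃[ j ] (x ≤ fromℕ j × (0# ≤ x → fromℕ j ≤ x + 1#))
    search zero    p = zero , p , λ 0≤x → +-nonNeg 0≤x 0≤1
    search (suc k) p with x ≤? fromℕ k
    ... | yes q = search k q
    ... | no q  = suc k , p , λ _ → ≤-trans (≤-reflexive (+-comm 1# _)) (+-monoˡ-≤ 1# (≰⇒≥ q))

  sum-mono-≤ : ∀ {n} {f g : Fin n → Carrier} → (∀ a → f a ≤ g a) → sum f ≤ sum g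
  sum-mono-≤ {zero}  f≤g = ≤-refl
  sum-mono-≤ {suc n} f≤g = +-mono-≤ (f≤g zero) (sum-mono-≤ (λ a → f≤g (suc a)))

  neg-mono-≤ : ∀ {x y} → x ≤ y → - y ≤ - x
  neg-mono-≤ {x} {y} x≤y = +-cancelʳ-≤ y (begin
    - y + y   ≈⟨ -‿inverseˡ y ⟩
    0#        ≈⟨ -‿inverseˡ x ⟨
    - x + x   ≤⟨ +-monoʳ-≤ (- x) x≤y ⟩
    - x + y   ∎)

  -- Below `N` the truncated difference has not yet stalled at 0, so an event costs it exactly 1.
  -- This expresses the drop of a potential through an indicator.
  countdown : ∀ N x b → x ℕ.< N →
    fromℕ (N ∸ (if b then suc x else x)) + ⟦ b ⟧ ≈ fromℕ (N ∸ x)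
  countdown N x false _ = +-identityʳ _
  countdown (suc N) x true (ℕ.s≤s x≤N) rewrite ℕ.+-∸-assoc 1 x≤N = +-comm _ _

  sum-indicator : ∀ {k} (g : Fin k → Carrier) b → sum (λ a → g a * ⟦ does (a ≟ b) ⟧) ≈ g b
  sum-indicator {suc k} g zero = begin-equality
    g zero * 1# + sum (λ a → g (suc a) * 0#)  ≈⟨ +-cong (*-identityʳ _) (trans (sum-cong-≋ (λ a → zeroʳ (g (suc a)))) (sum-replicate-zero k)) ⟩
    g zero + 0#                               ≈⟨ +-identityʳ _ ⟩
    g zero                                    ∎
  sum-indicator {suc k} g (suc b) = begin-equality
    g zero * 0# + sum (λ a → g (suc a) * ⟦ does (a ≟ b) ⟧)  ≈⟨ +-cong (zeroʳ _) (sum-indicator (λ a → g (suc a)) b) ⟩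
    0# + g (suc b)                                          ≈⟨ +-identityˡ _ ⟩
    g (suc b)                                               ∎

  ≤-indicator : ∀ {q} {Q : Set q} (Q? : Dec Q) {x} → x ≤ 1# → (¬ Q → x ≤ 0#) →
                x ≤ (if does Q? then 1# else 0#)
  ≤-indicator (yes _) x≤1 _   = x≤1
  ≤-indicator (no ¬q) _   x≤0 = x≤0 ¬q

-- The algorithm as a state machine on histories.

module CollisionCounting {c ℓ₁ ℓ₂} (R : ArchimedeanOrderedField c ℓ₁ ℓ₂) (K : ℕ) where
  open ArchimedeanOrderedField R hiding (zero)
  open OrderedField R
  open Proportional R

  -- mass is the total weight of the distinct items seen; exposure adds up, over all
  -- samples, the mass just before the sample, so it is Wν.
  record Tally : Set c where
    field
      repeats       : ℕ
      mass exposure : Carrier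

  open Tally public

  update : Tally → Carrier → Bool → Tally
  update t w old = record
    { repeats  = if old then suc (repeats t) else repeats t
    ; mass     = if old then mass t else mass t + w
    ; exposure = exposure t + mass t
    }

  -- comparing holds the tally before the latest sample, the weight of that sample,
  -- and whether it has already matched an earlier one.
  data State (m : ℕ) : Set c where
    settled   : Tally → State m
    comparing : Tally → Carrier → Bool → Fin m → Fin m → List (Fin m × Fin m) → State m

  compare : ∀ {m} → Tally → Carrier → Bool → List (Fin m × Fin m) → State m
  compare t w old []             = settled (update t w old)
  compare t w old ((i , j) ∷ ps) = comparing t w old i j ps

  answer : ∀ {m} → State m → Bool → State m
  answer (settled t)                b = settled t
  answer (comparing t w old _ _ ps) b = compare t w (old ∨ b) ps

  lastTally : ∀ {m} → State m → Tally
  lastTally (settled t)             = t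
  lastTally (comparing t _ _ _ _ _) = t

  emptyTally : Tally
  emptyTally = record { repeats = 0 ; mass = 0# ; exposure = 0# }

  -- All these tests are made even after a match, so that the number of steps per
  -- sample does not depend on the items.
  latestAgainstEarlier : ∀ m → List (Fin (suc m) × Fin (suc m))
  latestAgainstEarlier m = tabulate (λ i → zero , suc i)

  state : ∀ {m} → History m → State m
  state start                 = settled emptyTally
  state (sampled {m = m} h w) = compare (lastTally (state h)) w false (latestAgainstEarlier m)
  state (tested h b)          = answer (state h) b
  state (coinFlip h _)        = state h

  -- The outcome of the comparison is an argument so that proofs can split on it. The returned value
  -- is Wν/K.
  conclude : ∀ {m} (t : Tally) → K ℕ.≤ repeats t ⊎ repeats t ℕ.< K → Action m
  conclude t (inj₁ _) = return (exposure t / fromℕ K)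
  conclude t (inj₂ _) = sample

  act : ∀ {m} → State m → Action m
  act (settled t)             = conclude t (ℕ.≤-<-connex K (repeats t))
  act (comparing _ _ _ i j _) = test i j

  strategy : Strategy
  strategy h = act (state h)

  -- Expectation over a single proportional sample.

  module Analysis (I : Instance) (0<W : 0# < total I) where
    open Run strategy I
    open ≤-Reasoning hiding (start; stop)
    open RingProperties ring using ([y-z]x≈yx-zx)
    open AbelianGroupProperties +-abelianGroup using (⁻¹-anti-homo‿-) renaming (⁻¹-∙-comm to -‿+-comm)

    private
      n = size I
      W = total I

    p : Fin n → Carrier
    p a = weight I a / W

    -- Has the shape of the `sample` clause of `E′`, so a sampling step of a run unfolds to it by
    -- definition.
    𝔼 : (Fin n → Carrier) → Carrier
    𝔼 g = sum (λ a → p a * g a)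

    0≤p : ∀ a → 0# ≤ p a
    0≤p a = *-nonNeg (weight≥0 I a) (⁻¹-nonNeg 0<W)

    𝔼-mono : ∀ {f g} → (∀ a → f a ≤ g a) → 𝔼 f ≤ 𝔼 g
    𝔼-mono f≤g = sum-mono-≤ (λ a → *-monoˡ-≤ (0≤p a) (f≤g a))

    𝔼-cong : ∀ {f g} → (∀ a → f a ≈ g a) → 𝔼 f ≈ 𝔼 g
    𝔼-cong f≈g = sum-cong-≋ (λ a → *-congˡ (f≈g a))

    𝔼-+ : ∀ f g → 𝔼 (λ a → f a + g a) ≈ 𝔼 f + 𝔼 g
    𝔼-+ f g = trans (sum-cong-≋ (λ a → distribˡ (p a) (f a) (g a)))
                    (∑-distrib-+ (λ a → p a * f a) (λ a → p a * g a))

    𝔼-* : ∀ x g → 𝔼 (λ a → x * g a) ≈ x * 𝔼 g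
    𝔼-* x g = trans
      (sum-cong-≋ (λ a → solve 3 (λ p x g → p :* (x :* g) := x :* (p :* g)) refl (p a) x (g a)))
      (sym (*-distribˡ-sum x (λ a → p a * g a)))

    sum-p : sum p ≈ 1#
    sum-p = trans (sym (*-distribʳ-sum (W ⁻¹) (weight I))) (⁻¹-inverse 0<W)

    𝔼-const : ∀ x → 𝔼 (λ _ → x) ≈ x
    𝔼-const x = trans (sym (*-distribʳ-sum x p)) (trans (*-congʳ sum-p) (*-identityˡ x))

    𝔼-affine : ∀ x y g → 𝔼 (λ a → x + y * g a) ≈ x + y * 𝔼 g
    𝔼-affine x y g = trans (𝔼-+ (λ _ → x) (λ a → y * g a)) (+-cong (𝔼-const x) (𝔼-* y g))

    -- The items behind a history and the repeats among them.

    seen : ∀ {m} → Fin n → Vec (Fin n) m → Bool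
    seen a []       = false
    seen a (b ∷ xs) = does (a ≟ b) ∨ seen a xs

    -- Computed from the items themselves, which the algorithm cannot see; the invariant
    -- `state h ≡ settled (tally xs)` says that the tests recover it.
    tally : ∀ {m} → Vec (Fin n) m → Tally
    tally []       = emptyTally
    tally (a ∷ xs) = update (tally xs) (weight I a) (seen a xs)

    scan : ∀ {m} → Vec (Fin n) m → Bool → List (Fin m × Fin m) → Bool
    scan xs old []             = old
    scan xs old ((i , j) ∷ ps) = scan xs (old ∨ does (lookup xs i ≟ lookup xs j)) ps

    -- The positions `g` and the list `ys` they point to are general so that the induction can
    -- shorten `ys` while the scanned vector stays fixed.
    scan-tabulate : ∀ {m k} a (xs : Vec (Fin n) m) (g : Fin k → Fin (suc m)) (ys : Vec (Fin n) k) →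
                    (∀ i → lookup (a ∷ xs) (g i) ≡ lookup ys i) → ∀ old →
                    scan (a ∷ xs) old (tabulate (λ i → zero , g i)) ≡ old ∨ seen a ys
    scan-tabulate a xs g []       eq old = ≡.sym (∨-identityʳ old)
    scan-tabulate a xs g (y ∷ ys) eq old rewrite eq zero =
      ≡.trans (scan-tabulate a xs (λ i → g (suc i)) ys (λ i → eq (suc i)) _)
              (∨-assoc old (does (a ≟ y)) (seen a ys))

    scan-latest : ∀ {m} a (xs : Vec (Fin n) m) →
                  scan (a ∷ xs) false (latestAgainstEarlier m) ≡ seen a xs
    scan-latest a xs = scan-tabulate a xs suc xs (λ _ → ≡.refl) false

    comparisons : ∀ {m} ps {h : History m} {xs t w old} k f → state h ≡ compare t w old ps →
      ∃[ h′ ] (state h′ ≡ settled (update t w (scan xs old ps))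
               × E (length ps ℕ.+ k) h xs f ≡ E k h′ xs f)
    comparisons []             {h} k f eq = h , eq , ≡.refl
    comparisons ((i , j) ∷ ps) {h} {xs} k f eq rewrite eq =
      comparisons ps {tested h _} {xs} k f (≡.cong (λ s → answer s _) eq)

    -- A step budget for `d` further samples after `m`: each costs one step for itself and one per
    -- earlier sample, and the final 1 is the `return`.
    stepsFor : ℕ → ℕ → ℕ
    stepsFor zero    m = 1
    stepsFor (suc d) m = suc (length (latestAgainstEarlier m) ℕ.+ stepsFor d (suc m))

    -- A sum over distinct items: with `p` it is the hit rate, with the constant 1 the number of
    -- distinct items.
    collected : (Fin n → Carrier) → ∀ {m} → Vec (Fin n) m → Carrier
    collected g []       = 0#
    collected g (a ∷ xs) = if seen a xs then collected g xs else collected g xs + g a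

    -- Prepending an old item leaves the indicator of the seen set unchanged; prepending a new one
    -- adds the indicator of that item alone.
    sum-seen : ∀ g {m} (xs : Vec (Fin n) m) → sum (λ a → g a * ⟦ seen a xs ⟧) ≈ collected g xs
    sum-seen g []       = trans (sum-cong-≋ (λ a → zeroʳ (g a))) (sum-replicate-zero n)
    sum-seen g (b ∷ xs) with seen b xs in eq
    ... | true  = trans (sum-cong-≋ same) (sum-seen g xs)
      where
      same : ∀ a → g a * ⟦ seen a (b ∷ xs) ⟧ ≈ g a * ⟦ seen a xs ⟧
      same a with a ≟ b
      ... | yes ≡.refl rewrite eq = refl
      ... | no _                  = refl
    ... | false = begin-equality
      sum (λ a → g a * ⟦ seen a (b ∷ xs) ⟧)                                    ≈⟨ sum-cong-≋ split ⟩
      sum (λ a → g a * ⟦ seen a xs ⟧ + g a * ⟦ does (a ≟ b) ⟧)                 ≈⟨ ∑-distrib-+ (λ a → g a * ⟦ seen a xs ⟧) (λ a → g a * ⟦ does (a ≟ b) ⟧) ⟩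
      sum (λ a → g a * ⟦ seen a xs ⟧) + sum (λ a → g a * ⟦ does (a ≟ b) ⟧)     ≈⟨ +-cong (sum-seen g xs) (sum-indicator g b) ⟩
      collected g xs + g b                                                     ∎
      where
      split : ∀ a → g a * ⟦ seen a (b ∷ xs) ⟧ ≈ g a * ⟦ seen a xs ⟧ + g a * ⟦ does (a ≟ b) ⟧
      split a with a ≟ b
      ... | yes ≡.refl rewrite eq = sym (trans (+-congʳ (zeroʳ _)) (+-identityˡ _))
      ... | no _                  = sym (trans (+-congˡ (zeroʳ _)) (+-identityʳ _))

    hitRate : ∀ {m} → Vec (Fin n) m → Carrier
    hitRate xs = mass (tally xs) / W

    hitRate≈collected : ∀ {m} (xs : Vec (Fin n) m) → hitRate xs ≈ collected p xs
    hitRate≈collected []       = zeroˡ _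
    hitRate≈collected (a ∷ xs) with seen a xs
    ... | true  = hitRate≈collected xs
    ... | false = trans (distribʳ _ _ _) (+-congʳ (hitRate≈collected xs))

    -- This makes X - ν a martingale: each sample raises ν by exactly the conditional probability of
    -- a repeat.
    𝔼-seen : ∀ {m} (xs : Vec (Fin n) m) → 𝔼 (λ a → ⟦ seen a xs ⟧) ≈ hitRate xs
    𝔼-seen xs = trans (sum-seen p xs) (sym (hitRate≈collected xs))

    repeats+distinct : ∀ {m} (xs : Vec (Fin n) m) →
      fromℕ (repeats (tally xs)) + collected (λ _ → 1#) xs ≈ fromℕ m
    repeats+distinct []       = +-identityʳ 0#
    repeats+distinct (a ∷ xs) with seen a xs
    ... | true  = trans (+-assoc 1# _ _) (+-congˡ (repeats+distinct xs))
    ... | false = trans (sym (+-assoc _ _ _)) (trans (+-comm _ 1#) (+-congˡ (repeats+distinct xs)))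

    distinct≤size : ∀ {m} (xs : Vec (Fin n) m) → collected (λ _ → 1#) xs ≤ fromℕ n
    distinct≤size xs = begin
      collected (λ _ → 1#) xs          ≈⟨ sum-seen _ xs ⟨
      sum (λ a → 1# * ⟦ seen a xs ⟧)   ≤⟨ sum-mono-≤ (λ a → ≤-trans (≤-reflexive (*-identityˡ _)) ⟦ seen a xs ⟧≤1) ⟩
      sum {n = n} (λ _ → 1#)           ≈⟨ sum-replicate n ⟩
      fromℕ n                          ∎

    -- At most n samples can be new items. So every run is finite with a bound depending on n, which
    -- the analysis knows although the algorithm does not.
    many-samples⇒K≤repeats : ∀ {m} (xs : Vec (Fin n) m) → m ≡ n ℕ.+ K → K ℕ.≤ repeats (tally xs)
    many-samples⇒K≤repeats {m} xs ≡.refl = fromℕ-cancel-≤ (+-cancelʳ-≤ (fromℕ n) (begin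
      fromℕ K + fromℕ n                                     ≈⟨ trans (+-comm _ _) (sym (fromℕ-+ n K)) ⟩
      fromℕ m                                               ≈⟨ repeats+distinct xs ⟨
      fromℕ (repeats (tally xs)) + collected (λ _ → 1#) xs  ≤⟨ +-monoʳ-≤ _ (distinct≤size xs) ⟩
      fromℕ (repeats (tally xs)) + fromℕ n                  ∎))

    -- Optional stopping for sub- and supermartingales.

    estimate : ∀ {m} → Vec (Fin n) m → Carrier
    estimate xs = exposure (tally xs) / fromℕ K

    -- Repeats grow by at most one per sample, so a run stops with exactly `K` of them.
    repeats-step : ∀ {m} a (xs : Vec (Fin n) m) → repeats (tally xs) ℕ.< K → repeats (tally (a ∷ xs)) ℕ.≤ K
    repeats-step a xs r<K with seen a xs
    ... | true  = r<K
    ... | false = ℕ.<⇒≤ r<K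

    -- Optional stopping for a submartingale `G`. The induction is on the number `d` of samples left
    -- until n + K, when the run must have stopped.
    module LowerBound
      (f : Maybe Carrier → ℕ → Carrier)
      (G : ∀ {m} → Vec (Fin n) m → Carrier)
      (stop : ∀ {m} (xs : Vec (Fin n) m) → repeats (tally xs) ≡ K → G xs ≤ f (just (estimate xs)) m)
      (step : ∀ {m} (xs : Vec (Fin n) m) → repeats (tally xs) ℕ.< K → G xs ≤ 𝔼 (λ a → G (a ∷ xs)))
      where

      bound : ∀ d {m} (xs : Vec (Fin n) m) h → state h ≡ settled (tally xs) →
              repeats (tally xs) ℕ.≤ K → m ℕ.+ d ≡ n ℕ.+ K → G xs ≤ E (stepsFor d m) h xs f
      bound zero {m} xs h eq r≤K m+d rewrite eq with ℕ.≤-<-connex K (repeats (tally xs))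
      ... | inj₁ K≤r = stop xs (ℕ.≤-antisym r≤K K≤r)
      ... | inj₂ r<K = contradiction (many-samples⇒K≤repeats xs (≡.trans (≡.sym (ℕ.+-identityʳ m)) m+d)) (ℕ.<⇒≱ r<K)
      bound (suc d) {m} xs h eq r≤K m+d rewrite eq with ℕ.≤-<-connex K (repeats (tally xs))
      ... | inj₁ K≤r = stop xs (ℕ.≤-antisym r≤K K≤r)
      ... | inj₂ r<K = ≤-trans (step xs r<K) (𝔼-mono after)
        where
        after : ∀ a → G (a ∷ xs) ≤
          E (length (latestAgainstEarlier m) ℕ.+ stepsFor d (suc m)) (sampled h (weight I a)) (a ∷ xs) f
        after a with comparisons (latestAgainstEarlier m) {sampled h (weight I a)} {a ∷ xs} (stepsFor d (suc m)) f
                       (≡.cong (λ s → compare (lastTally s) (weight I a) false (latestAgainstEarlier m)) eq)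
        ... | h′ , eq′ , run rewrite run | scan-latest a xs =
          bound d (a ∷ xs) h′ eq′ (repeats-step a xs r<K) (≡.trans (≡.sym (ℕ.+-suc m d)) m+d)

    -- An upper bound has to hold when the run is cut off after any number of steps, so the
    -- invariant also covers histories in the middle of a block of tests: the tests still pending
    -- must complete the correct verdict.
    data Consistent : ∀ {m} → History m → Vec (Fin n) m → Set c where
      settled   : ∀ {m} {h : History m} {xs} → state h ≡ settled (tally xs) → Consistent h xs
      comparing : ∀ {m} {h : History (suc m)} {a xs old} i j ps →
                  state h ≡ comparing (tally xs) (weight I a) old i j ps →
                  scan (a ∷ xs) old ((i , j) ∷ ps) ≡ seen a xs → Consistent h (a ∷ xs)

    consistent : ∀ {m} {h : History (suc m)} {a xs old} ps →
                 state h ≡ compare (tally xs) (weight I a) old ps →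
                 scan (a ∷ xs) old ps ≡ seen a xs → Consistent h (a ∷ xs)
    consistent []             eq ≡.refl = settled eq
    consistent ((i , j) ∷ ps) eq scanned = comparing i j ps eq scanned

    -- Optional stopping for a supermartingale `G`. Since the cut-off is arbitrary, `stop` compares
    -- `f` with `G` at every list of items, not only at the last repeat.
    module UpperBound
      (f : Maybe Carrier → ℕ → Carrier)
      (G : ∀ {m} → Vec (Fin n) m → Carrier)
      (stop : ∀ {m} r (xs : Vec (Fin n) m) → f r m ≤ G xs)
      (step : ∀ {m} (xs : Vec (Fin n) m) → repeats (tally xs) ℕ.< K → 𝔼 (λ a → G (a ∷ xs)) ≤ G xs)
      where

      bound : ∀ k {m} (xs : Vec (Fin n) m) h → Consistent h xs → E k h xs f ≤ G xs
      bound zero    xs h _ = stop nothing xs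
      bound (suc k) xs h (settled eq) rewrite eq with ℕ.≤-<-connex K (repeats (tally xs))
      ... | inj₁ _   = stop _ xs
      ... | inj₂ r<K = ≤-trans (𝔼-mono after) (step xs r<K)
        where
        after : ∀ a → E k (sampled h (weight I a)) (a ∷ xs) f ≤ G (a ∷ xs)
        after a = bound k (a ∷ xs) _ (consistent (latestAgainstEarlier _)
          (≡.cong (λ s → compare (lastTally s) (weight I a) false (latestAgainstEarlier _)) eq)
          (scan-latest a xs))
      bound (suc k) xs h (comparing i j ps eq scanned) rewrite eq =
        bound k xs _ (consistent ps (≡.cong (λ s → answer s _) eq) scanned)

    -- Accuracy: the martingale X - ν and Chebyshev's inequality.

    deviation : ∀ {m} → Vec (Fin n) m → Carrier
    deviation xs = fromℕ (repeats (tally xs)) - exposure (tally xs) / W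

    -- The term K - X pays for the conditional variance of the martingale X - ν.
    Φ : ∀ {m} → Vec (Fin n) m → Carrier
    Φ xs = deviation xs * deviation xs + fromℕ (K ∸ repeats (tally xs))

    0≤Φ : ∀ {m} (xs : Vec (Fin n) m) → 0# ≤ Φ xs
    0≤Φ xs = +-nonNeg (0≤x*x _) (0≤fromℕ (K ∸ repeats (tally xs)))

    -- Let `e` be the deviation after a non-repeat, so the present one is `e + P`. A repeat replaces
    -- e² by (1 + e)², but the extra 1 cancels against the drop of K - X; what remains is affine in
    -- the indicator of a repeat.
    Φ-supermartingale : ∀ {m} (xs : Vec (Fin n) m) → repeats (tally xs) ℕ.< K →
                        𝔼 (λ a → Φ (a ∷ xs)) ≤ Φ xs
    Φ-supermartingale xs r<K = begin
      𝔼 (λ a → Φ (a ∷ xs))                                ≈⟨ 𝔼-cong affine ⟩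
      𝔼 (λ a → (e * e + k) + (2# * e) * ⟦ seen a xs ⟧)    ≈⟨ 𝔼-affine _ _ (λ a → ⟦ seen a xs ⟧) ⟩
      (e * e + k) + (2# * e) * 𝔼 (λ a → ⟦ seen a xs ⟧)    ≈⟨ +-congˡ (*-congˡ (𝔼-seen xs)) ⟩
      -- The added P² is the gap between the payment P and the conditional variance P - P²; it
      -- completes the square.
      (e * e + k) + (2# * e) * P                          ≤⟨ x≤x+y _ (0≤x*x P) ⟩
      (e * e + k) + (2# * e) * P + P * P                  ≈⟨ solve 3 (λ e k P → ((e :* e :+ k) :+ ((con 2 :* e) :* P)) :+ P :* P := (e :+ P) :* (e :+ P) :+ k) refl e k P ⟩
      (e + P) * (e + P) + k                               ≈⟨ +-congʳ (*-cong e+P≈deviation e+P≈deviation) ⟩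
      Φ xs                                                ∎
      where
      t = tally xs
      P = hitRate xs
      k = fromℕ (K ∸ repeats t)
      e = fromℕ (repeats t) - (exposure t + mass t) / W
      e+P≈deviation : e + P ≈ deviation xs
      e+P≈deviation = begin-equality
        (fromℕ (repeats t) - (exposure t + mass t) / W) + P     ≈⟨ +-congʳ (+-congˡ (-‿cong (distribʳ _ _ _))) ⟩
        (fromℕ (repeats t) - (exposure t / W + P)) + P          ≈⟨ +-congʳ (+-congˡ (-‿+-comm _ _)) ⟨
        (fromℕ (repeats t) + (- (exposure t / W) - P)) + P      ≈⟨ +-congʳ (+-assoc _ _ _) ⟨
        (deviation xs - P) + P                                  ≈⟨ x-y+y≈x _ P ⟩
        deviation xs                                            ∎
      affine : ∀ a → Φ (a ∷ xs) ≈ (e * e + k) + (2# * e) * ⟦ seen a xs ⟧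
      affine a with seen a xs | countdown K (repeats t) (seen a xs) r<K
      ... | false | _    = sym (trans (+-congˡ (zeroʳ _)) (+-identityʳ _))
      ... | true  | k′+1≈k = begin-equality
        (1# + fromℕ (repeats t) - (exposure t + mass t) / W) * (1# + fromℕ (repeats t) - (exposure t + mass t) / W) + k′
                                              ≈⟨ +-congʳ (*-cong (+-assoc 1# _ _) (+-assoc 1# _ _)) ⟩
        (1# + e) * (1# + e) + k′              ≈⟨ solve 2 (λ e k → (con 1 :+ e) :* (con 1 :+ e) :+ k := (e :* e :+ (k :+ con 1)) :+ (con 2 :* e) :* con 1) refl e k′ ⟩
        (e * e + (k′ + 1#)) + (2# * e) * 1#   ≈⟨ +-congʳ (+-congˡ k′+1≈k) ⟩
        (e * e + k) + (2# * e) * 1#           ∎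
        where k′ = fromℕ (K ∸ suc (repeats t))

    module _ {ε} (0<ε : 0# < ε) (3≤Kε² : fromℕ 3 ≤ fromℕ K * (ε * ε)) where

      0<K : 0# < fromℕ K
      0<K = 0≤fromℕ K , λ 0≈K → <⇒≱ (0<fromℕ 2) (begin
        fromℕ 3            ≤⟨ 3≤Kε² ⟩
        fromℕ K * (ε * ε)  ≈⟨ *-congʳ 0≈K ⟨
        0# * (ε * ε)       ≈⟨ zeroˡ _ ⟩
        0#                 ∎)

      -- With X = K and estimate Wν/K, a relative error beyond ε puts ν at distance at least εK from
      -- K.
      inaccurate⇒deviant : ∀ {m} (xs : Vec (Fin n) m) → repeats (tally xs) ≡ K →
        ¬ Accurate ε I (estimate xs) →
        (ε * fromℕ K) * (ε * fromℕ K) ≤ deviation xs * deviation xs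
      inaccurate⇒deviant xs r≡K ¬acc with (1# - ε) * W ≤? estimate xs
      -- The estimate is too high, so the deviation is negative and its negation is bounded from
      -- below.
      ... | yes lower = ≤-trans
          (*-mono-square 0≤εK (x+y≤z⇒x≤z-y above))
          (≤-reflexive (trans (*-cong flipped flipped) (-x*-x≈x*x _)))
        where
        k = fromℕ K
        ν = exposure (tally xs) / W
        0≤εK = *-nonNeg (proj₁ 0<ε) (proj₁ 0<K)
        flipped : ν - k ≈ - deviation xs
        flipped rewrite r≡K = sym (⁻¹-anti-homo‿- k ν)
        above : ε * k + k ≤ ν
        above = x*z≤y⇒x≤y/z 0<W (begin
          (ε * k + k) * W           ≈⟨ solve 3 (λ ε k W → (ε :* k :+ k) :* W := ((con 1 :+ ε) :* W) :* k) refl ε k W ⟩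
          ((1# + ε) * W) * k        ≤⟨ *-monoʳ-≤ (proj₁ 0<K) (≰⇒≥ (λ upper → ¬acc (lower , upper))) ⟩
          estimate xs * k           ≈⟨ x/y*y≈x _ 0<K ⟩
          exposure (tally xs)       ∎)
      ... | no ¬lower = *-mono-square (*-nonNeg (proj₁ 0<ε) (proj₁ 0<K)) (x+y≤z⇒x≤z-y below)
        where
        k = fromℕ K
        ν = exposure (tally xs) / W
        below : ε * k + ν ≤ fromℕ (repeats (tally xs))
        below rewrite r≡K = *-cancelʳ-≤ 0<W (begin
          (ε * k + ν) * W                    ≈⟨ distribʳ W _ ν ⟩
          (ε * k) * W + ν * W                ≈⟨ +-congˡ (trans (x/y*y≈x _ 0<W) (sym (x/y*y≈x _ 0<K))) ⟩
          (ε * k) * W + estimate xs * k      ≤⟨ +-monoʳ-≤ _ (*-monoʳ-≤ (proj₁ 0<K) (≰⇒≥ ¬lower)) ⟩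
          (ε * k) * W + ((1# - ε) * W) * k   ≈⟨ solve 4 (λ ε δ k W → (ε :* k) :* W :+ (δ :* W) :* k := ((δ :+ ε) :* k) :* W) refl ε (1# - ε) k W ⟩
          (((1# - ε) + ε) * k) * W           ≈⟨ *-congʳ (trans (*-congʳ (x-y+y≈x 1# ε)) (*-identityˡ k)) ⟩
          k * W                              ∎)

      maxSteps : ℕ
      maxSteps = stepsFor (n ℕ.+ K) 0

      halts : 1# ≤ HaltPr≤ maxSteps
      halts = LowerBound.bound _ (λ _ → 1#) (λ _ _ → ≤-refl)
        (λ _ _ → ≤-reflexive (sym (𝔼-const 1#))) (n ℕ.+ K) [] start ≡.refl ℕ.z≤n ≡.refl

      private
        t² = (ε * fromℕ K) * (ε * fromℕ K)
        0<t² : 0# < t²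
        0<t² = *-pos (*-pos 0<ε 0<K) (*-pos 0<ε 0<K)

      -- One minus the Chebyshev bound on failure. It is a submartingale because `Φ` is a
      -- supermartingale, so `LowerBound` applies to it.
      confidence : ∀ {m} → Vec (Fin n) m → Carrier
      confidence xs = 1# - Φ xs / t²

      accurate-often : fromℕ 2 / fromℕ 3 ≤ Pr≤ (accurate? ε I) maxSteps
      accurate-often = begin
        fromℕ 2 / fromℕ 3               ≤⟨ *-cancelʳ-≤ (0<fromℕ 2) (≤-trans (≤-reflexive (x/y*y≈x _ (0<fromℕ 2))) initially) ⟩
        confidence []                   ≤⟨ LowerBound.bound _ confidence stop step (n ℕ.+ K) [] start ≡.refl ℕ.z≤n ≡.refl ⟩
        Pr≤ (accurate? ε I) maxSteps    ∎
        where
        -- An accurate outcome needs only Φ ≥ 0; an inaccurate one has Φ ≥ t², which makes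
        -- `confidence` at most 0.
        stop : ∀ {m} (xs : Vec (Fin n) m) → repeats (tally xs) ≡ K →
               confidence xs ≤ (if does (accurate? ε I (estimate xs)) then 1# else 0#)
        stop xs r≡K = ≤-indicator (accurate? ε I (estimate xs))
          (≤-trans (x≤x+y _ (*-nonNeg (0≤Φ xs) (⁻¹-nonNeg 0<t²))) (≤-reflexive (x-y+y≈x 1# _)))
          (λ ¬acc → +-cancelʳ-≤ (Φ xs / t²) (begin
            confidence xs + Φ xs / t²  ≈⟨ x-y+y≈x 1# _ ⟩
            1#                         ≤⟨ x*z≤y⇒x≤y/z 0<t² (≤-trans (≤-reflexive (*-identityˡ t²))
                                            (≤-trans (inaccurate⇒deviant xs r≡K ¬acc) (x≤x+y _ (0≤fromℕ (K ∸ repeats (tally xs)))))) ⟩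
            Φ xs / t²                  ≈⟨ +-identityˡ _ ⟨
            0# + Φ xs / t²             ∎))
        step : ∀ {m} (xs : Vec (Fin n) m) → repeats (tally xs) ℕ.< K →
               confidence xs ≤ 𝔼 (λ a → confidence (a ∷ xs))
        step xs r<K = begin
          1# - Φ xs * t² ⁻¹                              ≈⟨ +-congˡ (-‿distribʳ _) ⟩
          1# + (- (t² ⁻¹)) * Φ xs                        ≤⟨ +-monoʳ-≤ 1# (begin
              - (t² ⁻¹) * Φ xs                           ≈⟨ -‿distribʳ _ ⟨
              - (Φ xs * t² ⁻¹)                           ≤⟨ neg-mono-≤ (*-monoʳ-≤ (⁻¹-nonNeg 0<t²) (Φ-supermartingale xs r<K)) ⟩
              - (𝔼 (λ a → Φ (a ∷ xs)) * t² ⁻¹)           ≈⟨ -‿distribʳ _ ⟩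
              - (t² ⁻¹) * 𝔼 (λ a → Φ (a ∷ xs))           ∎) ⟩
          1# + (- (t² ⁻¹)) * 𝔼 (λ a → Φ (a ∷ xs))        ≈⟨ 𝔼-affine 1# _ (λ a → Φ (a ∷ xs)) ⟨
          𝔼 (λ a → 1# + (- (t² ⁻¹)) * Φ (a ∷ xs))        ≈⟨ 𝔼-cong (λ a → +-congˡ (-‿distribʳ _)) ⟨
          𝔼 (λ a → confidence (a ∷ xs))                  ∎
          where
          -‿distribʳ : ∀ x → - (x * t² ⁻¹) ≈ - (t² ⁻¹) * x
          -‿distribʳ x = trans (-‿cong (*-comm x _)) (-‿distribˡ-* _ x)
        Φ[]≈K : Φ [] ≈ fromℕ K
        Φ[]≈K = trans (+-congʳ (trans (*-congʳ 0-0/W≈0) (zeroˡ _))) (+-identityˡ _)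
          where
          0-0/W≈0 : 0# - 0# / W ≈ 0#
          0-0/W≈0 = trans (+-congˡ (-‿cong (zeroˡ _))) (-‿inverseʳ 0#)
        -- Initially Φ is K, and 3K ≤ K(Kε²) = t², so the failure bound Φ/t² is at most 1/3.
        initially : fromℕ 2 ≤ confidence [] * fromℕ 3
        initially = begin
          fromℕ 2                                     ≤⟨ x+y≤z⇒x≤z-y (begin
            fromℕ 2 + Φ [] / t² * fromℕ 3             ≤⟨ +-monoʳ-≤ (fromℕ 2) (begin
              Φ [] / t² * fromℕ 3                     ≈⟨ solve 3 (λ x y z → (x :* y) :* z := (x :* z) :* y) refl _ _ _ ⟩
              (Φ [] * fromℕ 3) / t²                   ≤⟨ *-monoʳ-≤ (⁻¹-nonNeg 0<t²) (begin
                Φ [] * fromℕ 3                        ≈⟨ *-congʳ Φ[]≈K ⟩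
                fromℕ K * fromℕ 3                     ≤⟨ *-monoˡ-≤ (proj₁ 0<K) 3≤Kε² ⟩
                fromℕ K * (fromℕ K * (ε * ε))         ≈⟨ solve 2 (λ k ε → k :* (k :* (ε :* ε)) := (ε :* k) :* (ε :* k)) refl _ ε ⟩
                t²                                    ∎) ⟩
              t² / t²                                 ≈⟨ ⁻¹-inverse 0<t² ⟩
              1#                                      ∎) ⟩
            fromℕ 2 + 1#                              ≈⟨ +-comm _ _ ⟩
            fromℕ 3                                   ∎) ⟩
          fromℕ 3 - Φ [] / t² * fromℕ 3               ≈⟨ +-congʳ (*-identityˡ _) ⟨
          1# * fromℕ 3 - Φ [] / t² * fromℕ 3          ≈⟨ [y-z]x≈yx-zx _ _ _ ⟨
          confidence [] * fromℕ 3                     ∎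

    -- Running time: a potential bounding the expected number of samples.

    module _ (0<n : 0# < fromℕ n) (L : ℕ) (α : Carrier) (2≤α : 2# ≤ α)
             (2n≤αL : 2# * fromℕ n ≤ α * fromℕ L) where

      private
        2n = 2# * fromℕ n
        0<2 : 0# < 2#
        0<2 = <-≤-trans 0<1 (x≤x+y 1# 0≤1)
        0<2n : 0# < 2n
        0<2n = *-pos 0<2 0<n
        0≤α : 0# ≤ α
        0≤α = ≤-trans 0≤2 2≤α

      big : Fin n → Bool
      big a = does (1# ≤? 2n * p a)

      newBig : ∀ {m} → Vec (Fin n) m → Fin n → Bool
      newBig xs a = not (seen a xs) ∧ big a

      bigs : ∀ {m} → Vec (Fin n) m → ℕ
      bigs []       = 0
      bigs (a ∷ xs) = if newBig xs a then suc (bigs xs) else bigs xs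

      newBigRate : ∀ {m} → Vec (Fin n) m → Carrier
      newBigRate xs = 𝔼 (λ a → ⟦ newBig xs a ⟧)

      -- Each distinct big item contributes at least 1/(2n) to the hit rate.
      bigs≤hitRate : ∀ {m} (xs : Vec (Fin n) m) → fromℕ (bigs xs) ≤ 2n * hitRate xs
      bigs≤hitRate xs = ≤-trans (go xs) (≤-reflexive (*-congˡ (sym (hitRate≈collected xs))))
        where
        go : ∀ {m} (xs : Vec (Fin n) m) → fromℕ (bigs xs) ≤ 2n * collected p xs
        go []       = ≤-reflexive (sym (zeroʳ 2n))
        go (a ∷ xs) with seen a xs
        ... | true  = go xs
        ... | false with 1# ≤? 2n * p a
        ...   | yes 1≤ = begin
          1# + fromℕ (bigs xs)               ≤⟨ +-mono-≤ 1≤ (go xs) ⟩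
          2n * p a + 2n * collected p xs     ≈⟨ trans (+-comm _ _) (sym (distribˡ 2n _ _)) ⟩
          2n * (collected p xs + p a)        ∎
        ...   | no _   = ≤-trans (go xs) (*-monoˡ-≤ (proj₁ 0<2n) (x≤x+y _ (0≤p a)))

      -- An item neither seen nor big has probability at most 1/(2n), so all such items together
      -- have at most 1/2. The spare `1#` per item in `pointwise` accounts for them.
      hit-or-newBig : ∀ {m} (xs : Vec (Fin n) m) → 1# ≤ 2# * (hitRate xs + newBigRate xs)
      hit-or-newBig xs = *-cancelʳ-≤ 0<n (+-cancelʳ-≤ (fromℕ n) (begin
        1# * fromℕ n + fromℕ n                    ≈⟨ solve 1 (λ n → con 1 :* n :+ n := (con 2 :* n) :* con 1) refl (fromℕ n) ⟩
        2n * 1#                                   ≈⟨ *-congˡ sum-p ⟨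
        2n * sum p                                ≈⟨ *-distribˡ-sum 2n p ⟩
        sum (λ a → 2n * p a)                      ≤⟨ sum-mono-≤ pointwise ⟩
        sum (λ a → 2n * (p a * g a) + 1#)         ≈⟨ ∑-distrib-+ (λ a → 2n * (p a * g a)) (λ _ → 1#) ⟩
        sum (λ a → 2n * (p a * g a)) + sum {n = n} (λ _ → 1#)
                                                  ≈⟨ +-cong (sym (*-distribˡ-sum 2n (λ a → p a * g a))) (sum-replicate n) ⟩
        2n * 𝔼 g + fromℕ n                        ≈⟨ +-congʳ (*-congˡ (trans (𝔼-+ (λ a → ⟦ seen a xs ⟧) (λ a → ⟦ newBig xs a ⟧)) (+-congʳ (𝔼-seen xs)))) ⟩
        2n * (hitRate xs + newBigRate xs) + fromℕ n
                                                  ≈⟨ +-congʳ (solve 2 (λ n x → (con 2 :* n) :* x := (con 2 :* x) :* n) refl (fromℕ n) _) ⟩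
        2# * (hitRate xs + newBigRate xs) * fromℕ n + fromℕ n  ∎))
        where
        g : Fin n → Carrier
        g a = ⟦ seen a xs ⟧ + ⟦ newBig xs a ⟧
        covered : ∀ a {y} → y ≈ 1# → 2n * p a ≤ 2n * (p a * y) + 1#
        covered a y≈1 = ≤-trans
          (≤-reflexive (*-congˡ (sym (trans (*-congˡ y≈1) (*-identityʳ _))))) (x≤x+y _ 0≤1)
        pointwise : ∀ a → 2n * p a ≤ 2n * (p a * g a) + 1#
        pointwise a with seen a xs
        ... | true  = covered a (+-identityʳ 1#)
        ... | false with 1# ≤? 2n * p a
        ...   | yes _ = covered a (+-identityˡ 1#)
        ...   | no ¬1≤ = ≤-trans (≰⇒≥ ¬1≤) (≤-trans (≤-reflexive (sym (+-identityˡ 1#)))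
                          (+-monoˡ-≤ 1# (*-nonNeg (proj₁ 0<2n) (*-nonNeg (0≤p a) (+-nonNeg ≤-refl ≤-refl)))))

      -- A missing repeat is priced at α, a missing big item at 2. Before `L` big items are seen, a
      -- repeat or a new big item has probability at least 1/2 and either price is at least 2;
      -- afterwards the hit rate is at least L/(2n) ≥ 1/α. Either way the expected drop is at least
      -- 1.
      ψ : ∀ {m} → Vec (Fin n) m → Carrier
      ψ xs = α * fromℕ (K ∸ repeats (tally xs)) + 2# * fromℕ (L ∸ bigs xs)

      0≤ψ : ∀ {m} (xs : Vec (Fin n) m) → 0# ≤ ψ xs
      0≤ψ xs = +-nonNeg (*-nonNeg 0≤α (0≤fromℕ (K ∸ repeats (tally xs)))) (*-nonNeg 0≤2 (0≤fromℕ (L ∸ bigs xs)))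

      -- The coefficient γ drops to 0 when L big items have been seen, since then the
      -- truncated L ∸ bigs no longer decreases.
      bigs-drift : ∀ {m} (xs : Vec (Fin n) m) → ∃[ γ ]
        ((∀ a → 2# * fromℕ (L ∸ bigs (a ∷ xs)) + γ * ⟦ newBig xs a ⟧ ≤ 2# * fromℕ (L ∸ bigs xs))
         × 1# ≤ α * hitRate xs + γ * newBigRate xs)
      bigs-drift xs with ℕ.≤-<-connex L (bigs xs)
      ... | inj₂ bigs<L = 2# , (λ a → ≤-reflexive (trans (sym (distribˡ 2# _ _)) (*-congˡ (countdown L (bigs xs) (newBig xs a) bigs<L)))) , (begin
        1#                                       ≤⟨ hit-or-newBig xs ⟩
        2# * (hitRate xs + newBigRate xs)        ≈⟨ distribˡ 2# _ _ ⟩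
        2# * hitRate xs + 2# * newBigRate xs     ≤⟨ +-monoˡ-≤ _ (*-monoʳ-≤ (*-nonNeg (mass≥0 xs) (⁻¹-nonNeg 0<W)) 2≤α) ⟩
        α * hitRate xs + 2# * newBigRate xs      ∎)
        where
        mass≥0 : ∀ {m} (xs : Vec (Fin n) m) → 0# ≤ mass (tally xs)
        mass≥0 []       = ≤-refl
        mass≥0 (a ∷ xs) with seen a xs
        ... | true  = mass≥0 xs
        ... | false = +-nonNeg (mass≥0 xs) (weight≥0 I a)
      ... | inj₁ L≤bigs = 0# , (λ a → ≤-trans (≤-reflexive (trans (+-congˡ (zeroˡ _)) (+-identityʳ _)))
                                     (*-monoˡ-≤ 0≤2 (fromℕ-mono-≤ (ℕ.∸-monoʳ-≤ L (grows a))))) , (begin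
        1#                                       ≤⟨ *-cancelʳ-≤ 0<2n (begin
          1# * 2n                                ≈⟨ *-identityˡ 2n ⟩
          2n                                     ≤⟨ 2n≤αL ⟩
          α * fromℕ L                            ≤⟨ *-monoˡ-≤ 0≤α (fromℕ-mono-≤ L≤bigs) ⟩
          α * fromℕ (bigs xs)                    ≤⟨ *-monoˡ-≤ 0≤α (bigs≤hitRate xs) ⟩
          α * (2n * hitRate xs)                  ≈⟨ solve 3 (λ α n P → α :* (n :* P) := (α :* P) :* n) refl α 2n _ ⟩
          (α * hitRate xs) * 2n                  ∎) ⟩
        α * hitRate xs                           ≈⟨ trans (+-congˡ (zeroˡ _)) (+-identityʳ _) ⟨
        α * hitRate xs + 0# * newBigRate xs      ∎)
        where
        grows : ∀ a → bigs xs ℕ.≤ bigs (a ∷ xs)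
        grows a with newBig xs a
        ... | true  = ℕ.n≤1+n _
        ... | false = ℕ.≤-refl

      samplesBound : ∀ {m} → Vec (Fin n) m → Carrier
      samplesBound {m} xs = fromℕ m + ψ xs

      -- The expected drop of `ψ` pays for the sample just drawn. Adding 1 to both sides allows the
      -- drift to be added under the expectation, so nothing is subtracted.
      samplesBound-step : ∀ {m} (xs : Vec (Fin n) m) → repeats (tally xs) ℕ.< K →
                          𝔼 (λ a → samplesBound (a ∷ xs)) ≤ samplesBound xs
      samplesBound-step {m} xs r<K with bigs-drift xs
      ... | γ , bigs-step , 1≤drift = +-cancelʳ-≤ 1# (begin
        𝔼 (λ a → samplesBound (a ∷ xs)) + 1#                             ≤⟨ +-monoʳ-≤ _ 1≤drift ⟩
        𝔼 (λ a → samplesBound (a ∷ xs)) + (α * hitRate xs + γ * newBigRate xs)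
          ≈⟨ +-congˡ (+-cong (*-congˡ (sym (𝔼-seen xs))) refl) ⟩
        𝔼 (λ a → samplesBound (a ∷ xs)) + (α * 𝔼 (λ a → ⟦ seen a xs ⟧) + γ * newBigRate xs)
          ≈⟨ +-congˡ (+-cong (𝔼-* α (λ a → ⟦ seen a xs ⟧)) (𝔼-* γ (λ a → ⟦ newBig xs a ⟧))) ⟨
        𝔼 (λ a → samplesBound (a ∷ xs)) + (𝔼 (λ a → α * ⟦ seen a xs ⟧) + 𝔼 (λ a → γ * ⟦ newBig xs a ⟧))
          ≈⟨ trans (𝔼-+ (λ a → samplesBound (a ∷ xs)) _)
               (+-congˡ (𝔼-+ (λ a → α * ⟦ seen a xs ⟧) (λ a → γ * ⟦ newBig xs a ⟧))) ⟨
        𝔼 (λ a → samplesBound (a ∷ xs) + (α * ⟦ seen a xs ⟧ + γ * ⟦ newBig xs a ⟧))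
          ≤⟨ 𝔼-mono pointwise ⟩
        𝔼 (λ _ → samplesBound xs + 1#)                                   ≈⟨ 𝔼-const _ ⟩
        samplesBound xs + 1#                                             ∎)
        where
        r = repeats (tally xs)
        pointwise : ∀ a → samplesBound (a ∷ xs) + (α * ⟦ seen a xs ⟧ + γ * ⟦ newBig xs a ⟧) ≤ samplesBound xs + 1#
        pointwise a = begin
          samplesBound (a ∷ xs) + (α * ⟦ seen a xs ⟧ + γ * ⟦ newBig xs a ⟧)
            ≈⟨ solve 6 (λ m α u v s g → ((con 1 :+ m) :+ (α :* u :+ v)) :+ (α :* s :+ g) := (m :+ (α :* (u :+ s) :+ (v :+ g))) :+ con 1)
                 refl (fromℕ m) α _ _ _ _ ⟩
          fromℕ m + (α * (fromℕ (K ∸ repeats (tally (a ∷ xs))) + ⟦ seen a xs ⟧)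
                     + (2# * fromℕ (L ∸ bigs (a ∷ xs)) + γ * ⟦ newBig xs a ⟧)) + 1#
            ≤⟨ +-monoˡ-≤ 1# (+-monoʳ-≤ (fromℕ m) (+-mono-≤ (≤-reflexive (*-congˡ (countdown K r (seen a xs) r<K))) (bigs-step a))) ⟩
          samplesBound xs + 1# ∎

      expectedSamples≤ : ∀ k → Samples≤ k ≤ α * fromℕ K + 2# * fromℕ L
      expectedSamples≤ k = ≤-trans
        (UpperBound.bound (λ _ m → fromℕ m) samplesBound
          (λ {m} _ xs → x≤x+y (fromℕ m) (0≤ψ xs)) samplesBound-step k [] start (settled ≡.refl))
        (≤-reflexive (+-identityˡ _))

-- Choice of parameters and the final bounds.

module SumEstimator {c ℓ₁ ℓ₂} (R : ArchimedeanOrderedField c ℓ₁ ℓ₂) where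
  open ArchimedeanOrderedField R hiding (zero)
  open Proportional R
  open OrderedField R
  open ≤-Reasoning hiding (start; stop)

  repeatsNeeded : Carrier → ℕ
  repeatsNeeded ε = proj₁ (ceiling (fromℕ 3 / (ε * ε)))

  algorithm : Algorithm
  algorithm ε = CollisionCounting.strategy R (repeatsNeeded ε)

  module _ {ε} (0<ε : 0# < ε) (ε<1 : ε < 1#) where
    private
      K = repeatsNeeded ε
      i = ε ⁻¹
      i² = (ε * ε) ⁻¹

    0<ε² : 0# < ε * ε
    0<ε² = *-pos 0<ε 0<ε

    3≤Kε² : fromℕ 3 ≤ fromℕ K * (ε * ε)
    3≤Kε² = ≤-trans (≤-reflexive (sym (x/y*y≈x _ 0<ε²)))
      (*-monoʳ-≤ (proj₁ 0<ε²) (proj₁ (proj₂ (ceiling (fromℕ 3 / (ε * ε))))))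

    1≤i² : 1# ≤ i²
    1≤i² = begin
      1#            ≤⟨ x*z≤y⇒x≤y/z 0<ε² (≤-trans (*-monoˡ-≤ 0≤1 (*-mono-square (proj₁ 0<ε) (proj₁ ε<1)))
                                        (≤-reflexive (trans (*-identityˡ _) (*-identityˡ 1#)))) ⟩
      1# / (ε * ε)  ≈⟨ *-identityˡ i² ⟩
      i²            ∎

    -- Rounding up costs at most 1, which is at most 1/ε² because ε < 1.
    K≤4i² : fromℕ K ≤ fromℕ 4 * i²
    K≤4i² = begin
      fromℕ K             ≤⟨ proj₂ (proj₂ (ceiling (fromℕ 3 / (ε * ε)))) (*-nonNeg (0≤fromℕ 3) (⁻¹-nonNeg 0<ε²)) ⟩
      fromℕ 3 * i² + 1#   ≤⟨ +-monoʳ-≤ _ 1≤i² ⟩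
      fromℕ 3 * i² + i²   ≈⟨ trans (+-comm _ _) (trans (+-congʳ (sym (*-identityˡ i²))) (sym (distribʳ i² 1# _))) ⟩
      fromℕ 4 * i²        ∎

    εi²≈i : ε * i² ≈ i
    εi²≈i = begin-equality
      ε * i²             ≈⟨ x*y/y≈x _ 0<ε ⟨
      ((ε * i²) * ε) * i ≈⟨ *-congʳ (solve 2 (λ ε x → (ε :* x) :* ε := (ε :* ε) :* x) refl ε i²) ⟩
      ((ε * ε) * i²) * i ≈⟨ *-congʳ (⁻¹-inverse 0<ε²) ⟩
      1# * i             ≈⟨ *-identityˡ i ⟩
      i                  ∎

    -- Here αK is at most 8s/ε + 8/ε² and 2L at most 2s/ε + 2/ε², whence the constant 10.
    few-samples : (I : Instance) → 2 ℕ.≤ size I → 0# < total I → ∀ s → s ≥√ size I →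
      ExpectedSamples≤ (algorithm ε) I (fromℕ 10 * (s / ε + fromℕ ⌊log₂ size I ⌋ / (ε * ε)))
    few-samples I 2≤n 0<W s (0≤s , n≤s²) k = begin
      Run.Samples≤ (algorithm ε) I k                       ≤⟨ CollisionCounting.Analysis.expectedSamples≤ R K I 0<W 0<n L α 2≤α 2n≤αL k ⟩
      α * fromℕ K + 2# * fromℕ L                           ≤⟨ +-mono-≤ (*-monoˡ-≤ 0≤α K≤4i²) (*-monoˡ-≤ 0≤2 L≤si+i²) ⟩
      α * (fromℕ 4 * i²) + 2# * (s * i + i²)
        ≈⟨ solve 4 (λ s ε j i → (con 2 :* (s :* ε) :+ con 2) :* (numeral 4 :* j) :+ con 2 :* (s :* i :+ j)
                     := (numeral 8 :* (s :* (ε :* j)) :+ con 2 :* (s :* i)) :+ numeral 10 :* j) refl s ε i² i ⟩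
      (fromℕ 8 * (s * (ε * i²)) + 2# * (s * i)) + fromℕ 10 * i²
        ≈⟨ +-congʳ (+-congʳ (*-congˡ (*-congˡ εi²≈i))) ⟩
      (fromℕ 8 * (s * i) + 2# * (s * i)) + fromℕ 10 * i²
        ≈⟨ solve 2 (λ x j → (numeral 8 :* x :+ con 2 :* x) :+ numeral 10 :* j := numeral 10 :* (x :+ j)) refl (s * i) i² ⟩
      fromℕ 10 * (s * i + i²)                              ≤⟨ *-monoˡ-≤ (0≤fromℕ 10) (+-monoʳ-≤ _ i²≤log*i²) ⟩
      fromℕ 10 * (s / ε + fromℕ ⌊log₂ size I ⌋ / (ε * ε))  ∎
      where
      n = size I
      -- As L ≥ s/ε, the summand 2sε of `α` gives αL ≥ 2s² ≥ 2n; the summand 2 secures `2≤α`.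
      L = proj₁ (ceiling (s / ε))
      α = 2# * (s * ε) + 2#
      0≤2sε : 0# ≤ 2# * (s * ε)
      0≤2sε = *-nonNeg 0≤2 (*-nonNeg 0≤s (proj₁ 0<ε))
      0≤α : 0# ≤ α
      0≤α = +-nonNeg 0≤2sε 0≤2
      0<n : 0# < fromℕ n
      0<n = <-≤-trans (0<fromℕ 1) (fromℕ-mono-≤ 2≤n)
      2≤α : 2# ≤ α
      2≤α = ≤-trans (x≤x+y 2# 0≤2sε) (≤-reflexive (+-comm _ _))
      2n≤αL : 2# * fromℕ n ≤ α * fromℕ L
      2n≤αL = begin
        2# * fromℕ n                ≤⟨ *-monoˡ-≤ 0≤2 n≤s² ⟩
        2# * (s * s)                ≈⟨ *-congˡ (*-congˡ (x/y*y≈x s 0<ε)) ⟨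
        2# * (s * ((s / ε) * ε))    ≈⟨ solve 4 (λ t s ε x → t :* (s :* (x :* ε)) := (t :* (s :* ε)) :* x) refl 2# s ε (s / ε) ⟩
        2# * (s * ε) * (s / ε)      ≤⟨ *-monoˡ-≤ 0≤2sε (proj₁ (proj₂ (ceiling (s / ε)))) ⟩
        2# * (s * ε) * fromℕ L      ≤⟨ *-monoʳ-≤ (0≤fromℕ L) (x≤x+y _ 0≤2) ⟩
        α * fromℕ L                 ∎
      L≤si+i² : fromℕ L ≤ s * i + i²
      L≤si+i² = ≤-trans (proj₂ (proj₂ (ceiling (s / ε))) (*-nonNeg 0≤s (⁻¹-nonNeg 0<ε))) (+-monoʳ-≤ _ 1≤i²)
      -- From n ≥ 2 the rounded logarithm is at least 1, so 1/ε² is at most the second term of the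
      -- bound.
      i²≤log*i² : i² ≤ fromℕ ⌊log₂ n ⌋ / (ε * ε)
      i²≤log*i² = begin
        i²                              ≈⟨ *-identityˡ i² ⟨
        1# * i²                         ≈⟨ *-congʳ (+-identityʳ 1#) ⟨
        fromℕ 1 * i²                    ≤⟨ *-monoʳ-≤ (⁻¹-nonNeg 0<ε²) (fromℕ-mono-≤ (⌊log₂⌋-mono-≤ 2≤n)) ⟩
        fromℕ ⌊log₂ n ⌋ / (ε * ε)       ∎

theorem8 : ∀ {c ℓ₁ ℓ₂} (R : ArchimedeanOrderedField c ℓ₁ ℓ₂) →
    let open ArchimedeanOrderedField R
        open Proportional R
    in
    Σ[ A ∈ Algorithm ] Σ[ C ∈ Carrier ]
      (∀ (ε : Carrier) → 0# < ε → ε < 1# →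
       ∀ (I : Instance) → 2 ℕ.≤ size I → 0# < total I →
         HaltsAlmostSurely (A ε) I
         × ReturnsWithProbability≥ (A ε) I (fromℕ 2 / fromℕ 3) (accurate? ε I)
         × (∀ s → s ≥√ size I →
              ExpectedSamples≤ (A ε) I
                (C * (s / ε + fromℕ ⌊log₂ size I ⌋ / (ε * ε)))))
theorem8 R = algorithm , fromℕ 10 , λ ε 0<ε ε<1 I 2≤n 0<W →
  let open CollisionCounting.Analysis R (repeatsNeeded ε) I 0<W
      bound = 3≤Kε² 0<ε ε<1
  -- Every run has ended within `maxSteps`, so this one step count serves for all `q`.
  in (λ q q<1 → maxSteps 0<ε bound , <-≤-trans q<1 (halts 0<ε bound)) ,
     (λ q q<2/3 → maxSteps 0<ε bound , <-≤-trans q<2/3 (accurate-often 0<ε bound)) ,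
     few-samples 0<ε ε<1 I 2≤n 0<W
  where
  open ArchimedeanOrderedField R
  open OrderedField R
  open SumEstimator R
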